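{- Let $k\ge1$ and $\Gamma(k)=A_1\otimes\cdots\otimes A_k$ with $A_1,\dots,A_k\in\mathcal{Y}$. The tropical factor rank of each $C_\nu S_\nu^{k\,(\mathrm{mod}\,\gamma_\nu)}R_\nu[\Gamma(k)]$ is no more than $\gamma_\nu$, for $\nu=1,\dots,m$, and the tropical factor rank of $CS^{k\,(\mathrm{mod}\,\gamma)}R[\Gamma(k)]$ is no more than $\sum_{\nu=1}^m\gamma_\nu$.
   Context: **Tropical algebra and digraphs.** $\mathbb{R}_{\max}=\mathbb{R}\cup\{ -\infty\}$, $a\oplus b=\max(a,b)$, $a\otimes b=a+b$, $\varepsilon=-\infty$; $(A\otimes B)_{i,j}=\max_l(a_{i,l}+b_{l,j})$; matrix powers are tropical and $A^0=I$ ($0$ on the diagonal, $\varepsilon$ elsewhere). The tropical factor rank of $A\in\mathbb{R}_{\max}^{n\times p}$ is the smallest $r\in\mathbb{N}$ such that $A=U\otimes L$ with $U\in\mathbb{R}_{\max}^{n\times r}$, $L\in\mathbb{R}_{\max}^{r\times p}$. For an $n\times n$ matrix $A$, $\mathcal{D}(A)$ has nodes $1,\dots,n$ and an edge $(i,j)$ of weight $a_{i,j}$ iff $a_{i,j}\ne\varepsilon$. $A$ is irreducible if $\mathcal{D}(A)$ is strongly connected. $\lambda(A)$ is the maximal mean weight (weight/length) of cycles of $\mathcal{D}(A)$. The critical digraph $\mathbf{C}(A)$ consists of all nodes and edges lying on cycles of mean weight $\lambda(A)$. The cyclicity of a strongly connected digraph is the gcd of its cycle lengths; that of a disjoint union of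 strongly connected components is the lcm of their cyclicities. **Standing assumptions.** $\mathcal{X}$ is a nonempty, possibly infinite, set of $n\times n$ matrices over $\mathbb{R}_{\max}$, each irreducible with finite $\lambda$; $\mathcal{Y}=\{A-\lambda(A): A\in\mathcal{X}\}$ ($\lambda(A)$ subtracted from each entry). $A^{\sup}$, $A^{\inf}$ are the entrywise supremum and infimum of the matrices in $\mathcal{Y}$; $A^{\sup}$ has all entries in $\mathbb{R}_{\max}$. All matrices of $\mathcal{X}$ and $A^{\sup}$ have the same digraph $\mathcal{D}(\mathcal{X})=(N,E)$ (as unweighted digraph) and the same critical digraph $\mathbf{C}(\mathcal{X})=(\mathcal{N}_c,\mathcal{E}_c)$, whose strongly connected components are $\mathbf{C}_1,\dots,\mathbf{C}_m$. For $(i,j)\in E$, $(A^{\inf})_{i,j}\neq-\infty$. For all $A\in\mathcal{Y}$: $A_{i,j}=(A^{\sup})_{i,j}=0$ for $(i,j)\in\mathcal{E}_c$, and $A_{i,j}\le0$, $(A^{\sup})_{i,j}\le0$ for $(i,j)\notin\mathcal{E}_c$. **CSR.** Here $k\,(\mathrm{mod}\,g)\in\{0,\dots,g-1\}$. $S$ is the $n\times n$ matrix with $S_{i,j}=0$ if $(i,j)\in\mathcal{E}_c$ and $\varepsilon$ otherwise; $\gamma$ is the cyclicity of $\mathbf{C}(\mathcal{X})$; $T(S)$ is the least $T$ with $S^{l+\gamma}=S^l$ for all $l\ge T$; $t$ is any integer with $t\gamma\ge T(S)$; $C=\Gamma(k)\otimes S^{(t+1)\gamma-k(\mathrm{mod}\,\gamma)}$,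 $R=S^{(t+1)\gamma-k(\mathrm{mod}\,\gamma)}\otimes\Gamma(k)$; $CS^{k(\mathrm{mod}\,\gamma)}R[\Gamma(k)]=C\otimes S^{k(\mathrm{mod}\,\gamma)}\otimes R$. For each $\nu$, $S_\nu$, $\gamma_\nu$, $T(S_\nu)$, $t_\nu$, $C_\nu$, $R_\nu$ and $C_\nu S_\nu^{k(\mathrm{mod}\,\gamma_\nu)}R_\nu[\Gamma(k)]=C_\nu\otimes S_\nu^{k(\mathrm{mod}\,\gamma_\nu)}\otimes R_\nu$ are defined in the same way with the component $\mathbf{C}_\nu$ in place of $\mathbf{C}(\mathcal{X})$: $(S_\nu)_{i,j}=0$ if $(i,j)$ is an edge of $\mathbf{C}_\nu$ and $\varepsilon$ otherwise, $\gamma_\nu$ is the cyclicity of $\mathbf{C}_\nu$, $t_\nu\gamma_\nu\ge T(S_\nu)$, $C_\nu=\Gamma(k)\otimes S_\nu^{(t_\nu+1)\gamma_\nu-k(\mathrm{mod}\,\gamma_\nu)}$, $R_\nu=S_\nu^{(t_\nu+1)\gamma_\nu-k(\mathrm{mod}\,\gamma_\nu)}\otimes\Gamma(k)$. -}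

module Defs where

open import Algebra.Bundles using (CommutativeRing)
open import Axiom.ExcludedMiddle using (ExcludedMiddle)
open import Data.Bool.Base using (if_then_else_)
open import Data.Fin.Base using (Fin)
open import Data.Fin.Properties using (_≟_)
open import Data.Nat.Base as ℕ using (ℕ; zero; suc; _%_; _∸_)
open import Data.Nat.Divisibility using (_∣_)
open import Data.Nat.LCM using (lcm)
open import Data.Product.Base using (Σ; ∃; ∃-syntax; _×_; _,_)
open import Data.Sum.Base using (_⊎_; inj₁; inj₂)
open import Data.Unit.Base using (⊤)
open import Data.Vec.Functional using (Vector; foldr)
open import Function.Base using (flip)
open import Level using (0ℓ; _⊔_)
open import Relation.Binary.Bundles using (TotalOrder)
open import Relation.Binary.Core using (Rel; _⇔_)
open import Relation.Binary.PropositionalEquality.Core using (_≡_; _≢_; refl)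
open import Relation.Binary.Structures using (IsTotalOrder)
open import Relation.Binary.Construct.Closure.ReflexiveTransitive using (Star)
open import Relation.Binary.Construct.Closure.Transitive
  using (TransClosure; [_]; _∷_)
open import Relation.Nullary.Construct.Add.Infimum using (_₋; ⊥₋; [_])
open import Relation.Nullary.Decidable.Core using (does)
open import Relation.Nullary.Negation.Core using (¬_; contradiction)
open import Relation.Unary using (Pred; _≐_)

import Algebra.Construct.NaturalChoice.Max as NaturalMax
import Algebra.Definitions.RawMonoid as RawMonoidDefs
import Relation.Binary.Construct.Add.Infimum.Equality as InfimumEquality
import Relation.Binary.Construct.Add.Infimum.NonStrict as InfimumNonStrict

------------------------------------------------------------------------
-- Suprema and the real numbers

IsSupremum : ∀ {a ℓ p} {A : Set a} → Rel A ℓ → Pred A p → A → Set (a ⊔ ℓ ⊔ p)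
IsSupremum _≤_ P s =
  (∀ x → P x → x ≤ s) × (∀ u → (∀ x → P x → x ≤ u) → s ≤ u)

IsInfimum : ∀ {a ℓ p} {A : Set a} → Rel A ℓ → Pred A p → A → Set (a ⊔ ℓ ⊔ p)
IsInfimum _≤_ = IsSupremum (flip _≤_)

-- ℝ is introduced by its usual characterisation, the Dedekind-complete
-- totally ordered field, which in classical mathematics is unique up to
-- isomorphism.  Inversion is total; its value at zero is irrelevant.

record RealNumbers : Set₁ where
  infix  4 _≤_
  infix  8 _⁻¹
  field
    commutativeRing : CommutativeRing 0ℓ 0ℓ

  open CommutativeRing commutativeRing public

  field
    _≤_          : Rel Carrier 0ℓ
    _⁻¹          : Carrier → Carrier
    isTotalOrder : IsTotalOrder _≈_ _≤_
    0≉1          : ¬ (0# ≈ 1#)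
    inverseʳ     : ∀ x → ¬ (x ≈ 0#) → x * x ⁻¹ ≈ 1#
    +-monoˡ-≤    : ∀ x y z → x ≤ y → x + z ≤ y + z
    *-nonneg     : ∀ x y → 0# ≤ x → 0# ≤ y → 0# ≤ x * y
    complete     : (P : Pred Carrier 0ℓ) → ∃ P → (∃[ u ] ∀ x → P x → x ≤ u) →
                   ∃ (IsSupremum _≤_ P)

  open RawMonoidDefs +-rawMonoid public using () renaming (_×_ to _·_)

  fromℕ : ℕ → Carrier
  fromℕ k = k · 1#

------------------------------------------------------------------------
-- Digraphs

record Digraph (n : ℕ) : Set₁ where
  field
    Node      : Pred (Fin n) 0ℓ
    Edge      : Rel (Fin n) 0ℓ
    endpoints : ∀ {i j} → Edge i j → Node i × Node j

open Digraph public

private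
  variable
    n : ℕ

infix 4 _≃_

_≃_ : Rel (Digraph n) 0ℓ
G ≃ H = (Node G ≐ Node H) × (Edge G ⇔ Edge H)

-- Cycles are closed walks of positive length; inner nodes may repeat.  A
-- closed walk splits into elementary cycles, so this changes neither the
-- maximal mean weight, nor the critical digraph, nor the gcd of the lengths.

Cycle : Digraph n → Set
Cycle G = ∃[ i ] TransClosure (Edge G) i i

walkLength : ∀ {E : Rel (Fin n) 0ℓ} {i j} → TransClosure E i j → ℕ
walkLength [ _ ]   = 1
walkLength (_ ∷ w) = suc (walkLength w)

cycleLength : ∀ {G : Digraph n} → Cycle G → ℕ
cycleLength (_ , w) = walkLength w

EdgeOnWalk : ∀ {E : Rel (Fin n) 0ℓ} {i j} →
             Fin n → Fin n → TransClosure E i j → Set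
EdgeOnWalk p q ([_] {x} {y} _)       = p ≡ x × q ≡ y
EdgeOnWalk p q (_∷_ {x} {y} {_} _ w) = (p ≡ x × q ≡ y) ⊎ EdgeOnWalk p q w

EdgeOnCycle : ∀ {G : Digraph n} → Fin n → Fin n → Cycle G → Set
EdgeOnCycle p q (_ , w) = EdgeOnWalk p q w

StronglyConnected : Digraph n → Set
StronglyConnected G = ∀ i j → Node G i → Node G j → Star (Edge G) i j

-- The strongly connected component of i: the subdigraph of G induced on the
-- nodes mutually reachable with i.

component : Digraph n → Fin n → Digraph n
component {n} G i = record
  { Node      = InComponent
  ; Edge      = λ p q → Edge G p q × InComponent p × InComponent q
  ; endpoints = λ (_ , p∈ , q∈) → p∈ , q∈
  }
  where
  InComponent : Pred (Fin n) 0ℓ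
  InComponent p = Node G p × Star (Edge G) i p × Star (Edge G) p i

-- H₁, …, H_m is a list without repetitions of all components of G.

record AreComponents {m} (G : Digraph n) (H : Fin m → Digraph n) : Set where
  field
    isComponent : ∀ ν → ∃[ i ] Node G i × H ν ≃ component G i
    exhaustive  : ∀ i → Node G i → ∃[ ν ] H ν ≃ component G i
    distinct    : ∀ ν μ → H ν ≃ H μ → ν ≡ μ

-- Cyclicity of a strongly connected digraph: the gcd of all cycle lengths,
-- of which there are in general infinitely many.

record IsCyclicity (G : Digraph n) (γ : ℕ) : Set where
  field
    divides  : ∀ (c : Cycle G) → γ ∣ cycleLength {G = G} c
    greatest : ∀ d → (∀ (c : Cycle G) → d ∣ cycleLength {G = G} c) → d ∣ γ

lcmAll : ∀ {m} → Vector ℕ m → ℕ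
lcmAll = foldr lcm 1

sumAll : ∀ {m} → Vector ℕ m → ℕ
sumAll = foldr ℕ._+_ 0

-- Only nonzero moduli matter: a component of a critical digraph contains a
-- cycle, hence has positive cyclicity.

infixl 7 _mod_

_mod_ : ℕ → ℕ → ℕ
k mod zero  = k
k mod suc g = k % suc g

------------------------------------------------------------------------
-- Tropical matrices and CSR terms.  The mathematics is classical: excluded
-- middle is a parameter.

module Tropical (em : ExcludedMiddle 0ℓ) (ℝ : RealNumbers) where

  private
    module ℝ = RealNumbers ℝ

  open InfimumEquality ℝ._≈_ public using (_≈₋_)
  open InfimumNonStrict ℝ._≤_ public using (_≤₋_; ≤₋-isTotalOrder)

  ℝmax : Set
  ℝmax = ℝ.Carrier ₋

  ε : ℝmax
  ε = ⊥₋

  ℝmax-totalOrder : TotalOrder 0ℓ 0ℓ 0ℓ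
  ℝmax-totalOrder = record { isTotalOrder = ≤₋-isTotalOrder ℝ.isTotalOrder }

  open NaturalMax ℝmax-totalOrder public using () renaming (_⊔_ to _⊕_)

  infixl 7 _⊗_

  _⊗_ : ℝmax → ℝmax → ℝmax
  [ x ] ⊗ [ y ] = [ x ℝ.+ y ]
  [ _ ] ⊗ ⊥₋    = ε
  ⊥₋    ⊗ _     = ε

  ⨁ : ∀ {r} → Vector ℝmax r → ℝmax
  ⨁ = foldr _⊕_ ε

  Matrix : ℕ → ℕ → Set
  Matrix n p = Fin n → Fin p → ℝmax

  infix 4 _≋_

  _≋_ : ∀ {p} → Rel (Matrix n p) 0ℓ
  A ≋ B = ∀ i j → A i j ≈₋ B i j

  infixl 7 _⊗ᴹ_
  infixr 8 _^ᴹ_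

  _⊗ᴹ_ : ∀ {p r} → Matrix n r → Matrix r p → Matrix n p
  (A ⊗ᴹ B) i j = ⨁ (λ l → A i l ⊗ B l j)

  I : Matrix n n
  I i j = if does (i ≟ j) then [ ℝ.0# ] else ε

  _^ᴹ_ : Matrix n n → ℕ → Matrix n n
  A ^ᴹ zero  = I
  A ^ᴹ suc k = A ⊗ᴹ (A ^ᴹ k)

  ∏ : ∀ {k} → Vector (Matrix n n) k → Matrix n n
  ∏ = foldr _⊗ᴹ_ I

  Factorises : ∀ {p} → Matrix n p → ℕ → Set
  Factorises {n} {p} A r =
    Σ (Matrix n r) λ U → Σ (Matrix r p) λ L → A ≋ U ⊗ᴹ L

  IsFactorRank : ∀ {p} → Matrix n p → ℕ → Set
  IsFactorRank A r = Factorises A r × (∀ s → Factorises A s → r ℕ.≤ s)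

  FactorRankAtMost : ∀ {p} → Matrix n p → ℕ → Set
  FactorRankAtMost A g = ∃[ r ] IsFactorRank A r × r ℕ.≤ g

  ----------------------------------------------------------------------
  -- Weighted digraphs

  𝒟 : Matrix n n → Digraph n
  𝒟 A = record
    { Node      = λ _ → ⊤
    ; Edge      = λ i j → A i j ≢ ε
    ; endpoints = λ _ → _
    }

  Irreducible : Matrix n n → Set
  Irreducible A = StronglyConnected (𝒟 A)

  finite : (x : ℝmax) → x ≢ ε → ℝ.Carrier
  finite [ x ] _   = x
  finite ⊥₋    ε≢ε = contradiction refl ε≢ε

  walkWeight : ∀ (A : Matrix n n) {i j} →
               TransClosure (Edge (𝒟 A)) i j → ℝ.Carrier
  walkWeight A ([_] {x} {y} e)       = finite (A x y) e
  walkWeight A (_∷_ {x} {y} {_} e w) = finite (A x y) e ℝ.+ walkWeight A w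

  mean : (A : Matrix n n) → Cycle (𝒟 A) → ℝ.Carrier
  mean A (_ , w) = walkWeight A w ℝ.* (ℝ.fromℕ (walkLength w)) ℝ.⁻¹

  IsMaxCycleMean : Matrix n n → ℝ.Carrier → Set
  IsMaxCycleMean A λᴬ =
    (∃[ c ] mean A c ℝ.≈ λᴬ) × (∀ c → mean A c ℝ.≤ λᴬ)

  IsCriticalCycle : (A : Matrix n n) → Cycle (𝒟 A) → Set
  IsCriticalCycle A c = ∃[ λᴬ ] IsMaxCycleMean A λᴬ × mean A c ℝ.≈ λᴬ

  -- A node lies on a cycle iff some edge of the cycle leaves it or, equally,
  -- some edge of the cycle enters it.

  critical : Matrix n n → Digraph n
  critical A = record
    { Node      = λ i → (∃[ j ] CriticalEdge i j) ⊎ (∃[ j ] CriticalEdge j i)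
    ; Edge      = CriticalEdge
    ; endpoints = λ e → inj₁ (_ , e) , inj₂ (_ , e)
    }
    where
    CriticalEdge : Rel (Fin _) 0ℓ
    CriticalEdge i j =
      ∃[ c ] IsCriticalCycle A c × EdgeOnCycle {G = 𝒟 A} i j c

  ----------------------------------------------------------------------
  -- Standing assumptions

  Normalised : Pred (Matrix n n) 0ℓ → Pred (Matrix n n) 0ℓ
  Normalised 𝒳 B =
    ∃[ A ] 𝒳 A × ∃[ λᴬ ] IsMaxCycleMean A λᴬ ×
    B ≋ (λ i j → A i j ⊗ [ ℝ.- λᴬ ])

  Entries : Pred (Matrix n n) 0ℓ → Fin n → Fin n → Pred ℝmax 0ℓ
  Entries 𝒴 i j x = ∃[ B ] 𝒴 B × x ≡ B i j

  -- G and C are the common digraph and the common critical digraph of 𝒳.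
  -- A supremum or infimum is taken in ℝmax, so that Aˢᵘᵖ has no entry +∞ and
  -- an infimum always exists, being ε for a set without real lower bound.

  record StandingAssumptions
    (𝒳 : Pred (Matrix n n) 0ℓ) (Aˢᵘᵖ Aⁱⁿᶠ : Matrix n n) (G C : Digraph n)
    : Set where
    private
      𝒴 = Normalised 𝒳
    field
      nonempty     : ∃ 𝒳
      irreducible  : ∀ A → 𝒳 A → Irreducible A
      finite-λ     : ∀ A → 𝒳 A → ∃ (IsMaxCycleMean A)
      isSup        : ∀ i j → IsSupremum _≤₋_ (Entries 𝒴 i j) (Aˢᵘᵖ i j)
      isInf        : ∀ i j → IsInfimum  _≤₋_ (Entries 𝒴 i j) (Aⁱⁿᶠ i j)
      digraph      : ∀ A → 𝒳 A → 𝒟 A ≃ G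
      digraph-sup  : 𝒟 Aˢᵘᵖ ≃ G
      critical-𝒳   : ∀ A → 𝒳 A → critical A ≃ C
      critical-sup : critical Aˢᵘᵖ ≃ C
      inf-finite   : ∀ i j → Edge G i j → Aⁱⁿᶠ i j ≢ ε
      zero-𝒴       : ∀ A → 𝒴 A → ∀ i j → Edge C i j → A i j ≈₋ [ ℝ.0# ]
      zero-sup     : ∀ i j → Edge C i j → Aˢᵘᵖ i j ≈₋ [ ℝ.0# ]
      nonpos-𝒴     : ∀ A → 𝒴 A → ∀ i j → ¬ Edge C i j → A i j ≤₋ [ ℝ.0# ]
      nonpos-sup   : ∀ i j → ¬ Edge C i j → Aˢᵘᵖ i j ≤₋ [ ℝ.0# ]

  ----------------------------------------------------------------------
  -- CSR

  𝑆 : Digraph n → Matrix n n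
  𝑆 H i j = if does (em {P = Edge H i j}) then [ ℝ.0# ] else ε

  IsPeriodicFrom : Matrix n n → ℕ → ℕ → Set
  IsPeriodicFrom S γ T = ∀ l → T ℕ.≤ l → S ^ᴹ (l ℕ.+ γ) ≋ S ^ᴹ l

  IsTransient : Matrix n n → ℕ → ℕ → Set
  IsTransient S γ T =
    IsPeriodicFrom S γ T × (∀ T′ → IsPeriodicFrom S γ T′ → T ℕ.≤ T′)

  CSR : (H : Digraph n) (γ t k : ℕ) → Matrix n n → Matrix n n
  CSR H γ t k Γ = (Γ ⊗ᴹ P) ⊗ᴹ (𝑆 H ^ᴹ (k mod γ)) ⊗ᴹ (P ⊗ᴹ Γ)
    where
    P = 𝑆 H ^ᴹ ((t ℕ.+ 1) ℕ.* γ ∸ k mod γ)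

{-# OPTIONS --safe #-}
module Submission where

-- The power P = S^e, with e beyond the transient T(S), is the indicator matrix
-- of the walks of length e.  Fix a root r_ν in each component.  There is a walk
-- of length e from i to j iff, for some ν and some residue c modulo γ_ν, r_ν is
-- reached from i in −c steps and from j in −(c + e) steps modulo γ_ν: some
-- closed walk lengths at r_ν differ by exactly γ_ν, so the length of i → r_ν → j
-- can be corrected to e modulo the period of S, which suffices by periodicity.
-- Hence P factors through the Σ γ_ν pairs (ν , c), and so does
-- CSR = (Γ P S^(k mod γ)) (P Γ).

open import Defs
open import Algebra.Bundles using (CommutativeSemiring)
open import Algebra.Definitions using (Congruent₂; Commutative; LeftIdentity; Associative)
open import Axiom.ExcludedMiddle using (ExcludedMiddle)
open import Data.Bool.Base using (if_then_else_)
open import Data.Fin.Base using (Fin; zero; suc; toℕ; fromℕ<; splitAt; _↑ˡ_; _↑ʳ_)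
open import Data.Fin.Properties using (_≟_; toℕ-fromℕ<; splitAt-↑ˡ; splitAt-↑ʳ)
open import Data.Nat.Base using (ℕ; zero; suc; _+_; _*_; _∸_; _%_; _/_; _≤_; _<_; NonZero; z≤n; s≤s; >-nonZero)
open import Data.Nat.Divisibility
  using (_∣_; divides; _∣0; 0∣⇒≡0; n∣m*n; m∣m*n; ∣m∣n⇒∣m+n; ∣m+n∣m⇒∣n)
open import Data.Nat.DivMod using (m≡m%n+[m/n]*n; m%n<n)
open import Data.Nat.GCD using (gcd)
open import Data.Nat.Induction using (<-rec)
open import Data.Nat.LCM using (lcm; gcd*lcm)
open import Data.Nat.Properties
  using (+-comm; +-suc; +-identityʳ; +-monoʳ-≤; *-zeroʳ; *-mono-<; *-distribˡ-+;
         ≤-refl; ≤-trans; ≤-<-trans; <⇒≤; <⇒≢; ≤⇒≯; ≮⇒≥; n≢0⇒n>0; m≤n⇒m≤n+o;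
         m+n≤o⇒m≤o∸n; module ≤-Reasoning)
open import Data.Nat.Tactic.RingSolver using (solve-∀)
open import Data.Product.Base using (Σ; ∃; ∃-syntax; _×_; _,_; proj₁; proj₂)
open import Data.Sum.Base using (_⊎_; inj₁; inj₂)
open import Data.Vec.Functional using (Vector)
open import Function.Base using (_∘_)
open import Level using (0ℓ)
open import Relation.Binary.Construct.Closure.ReflexiveTransitive using (Star; _◅_; _◅◅_)
  renaming (ε to []★)
open import Relation.Binary.Construct.Closure.Transitive using (TransClosure; [_]; _∷_)
open import Relation.Binary.Core using (Rel; _⇒_)
open import Relation.Binary.PropositionalEquality.Core using (_≡_; refl; sym; trans; cong; subst)
open import Relation.Binary.Structures using (IsEquivalence)
open import Relation.Nullary.Construct.Add.Infimum using (⊥₋; [_])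
open import Relation.Nullary.Decidable.Core using (yes; no; does)
open import Relation.Nullary.Negation.Core using (¬_; contradiction)
open import Relation.Unary using (Pred)

import Algebra.Construct.NaturalChoice.Max as NaturalMax
import Algebra.Properties.Semiring.Sum as SemiringSum
import Algebra.Structures.Biased as Biased
import Relation.Binary.Construct.Add.Infimum.Equality as InfimumEquality
import Relation.Binary.Construct.Add.Infimum.NonStrict as InfimumNonStrict
import Relation.Binary.Reasoning.Setoid as SetoidReasoning

-- Arithmetic

-- `g * x` is `-x` modulo `γ = g + 1`, so its remainder serves as `c`.
complement : ∀ γ .{{_ : NonZero γ}} x → ∃ λ (c : Fin γ) → γ ∣ x + toℕ c
complement γ@(suc g) x = c , ∣m+n∣m⇒∣n γ∣total (n∣m*n (g * x / γ))
  where
  c = fromℕ< (m%n<n (g * x) γ)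
  rearrange : ∀ q x r → q + (x + r) ≡ x + (r + q)
  rearrange = solve-∀
  γ∣total : γ ∣ g * x / γ * γ + (x + toℕ c)
  γ∣total = subst (γ ∣_)
    (trans (cong (x +_) (m≡m%n+[m/n]*n (g * x) γ))
      (trans (sym (rearrange (g * x / γ * γ) x (g * x % γ)))
        (cong (λ r → g * x / γ * γ + (x + r)) (sym (toℕ-fromℕ< (m%n<n (g * x) γ))))))
    (m∣m*n x)

lcmAll>0 : ∀ {m} (γ : Vector ℕ m) → (∀ ν → 0 < γ ν) → 0 < lcmAll γ
lcmAll>0 {zero}  γ γ>0 = s≤s z≤n
lcmAll>0 {suc m} γ γ>0 = n≢0⇒n>0 λ lcm≡0 →
  <⇒≢ (*-mono-< (γ>0 zero) (lcmAll>0 (γ ∘ suc) (γ>0 ∘ suc)))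
    (sym (trans (sym (gcd*lcm a b)) (trans (cong (gcd a b *_) lcm≡0) (*-zeroʳ (gcd a b)))))
  where
  a = γ zero
  b = lcmAll (γ ∘ suc)

sumAll-index : ∀ {m} (γ : Vector ℕ m) → Fin (sumAll γ) → Σ (Fin m) (Fin ∘ γ)
sumAll-index {suc m} γ s with splitAt (γ zero) s
... | inj₁ c = zero , c
... | inj₂ s′ with sumAll-index (γ ∘ suc) s′
...   | ν , c = suc ν , c

-- Turns the class found for a walk into an inner index of the factorisation.
sumAll-index-surjective :
  ∀ {m} (γ : Vector ℕ m) p → ∃[ s ] sumAll-index γ s ≡ p
sumAll-index-surjective {suc m} γ (zero , c) = c ↑ˡ _ , eq
  where
  eq : sumAll-index γ (c ↑ˡ _) ≡ (zero , c)
  eq rewrite splitAt-↑ˡ (γ zero) c (sumAll (γ ∘ suc)) = refl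
sumAll-index-surjective {suc m} γ (suc ν , c)
  with sumAll-index-surjective (γ ∘ suc) (ν , c)
... | s , eq = γ zero ↑ʳ s , eq′
  where
  eq′ : sumAll-index γ (γ zero ↑ʳ s) ≡ (suc ν , c)
  eq′ rewrite splitAt-↑ʳ (γ zero) (sumAll (γ ∘ suc)) s | eq = refl

module _ (em : ExcludedMiddle 0ℓ) where

  -- Either a smaller number satisfies `P`, and induction applies to it, or `k` is itself least.
  least : (P : Pred ℕ 0ℓ) → ∀ k → P k → ∃[ l ] P l × l ≤ k × (∀ j → P j → l ≤ j)
  least P = <-rec _ step
    where
    step : ∀ k → (∀ {l} → l < k → P l → ∃[ l′ ] P l′ × l′ ≤ l × (∀ j → P j → l′ ≤ j)) →
           P k → ∃[ l ] P l × l ≤ k × (∀ j → P j → l ≤ j)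
    step k rec Pk with em {∃[ l ] l < k × P l}
    ... | yes (l , l<k , Pl) with rec l<k Pl
    ...   | l′ , Pl′ , l′≤l , l′-least = l′ , Pl′ , ≤-trans l′≤l (<⇒≤ l<k) , l′-least
    step k rec Pk | no ∄l = k , Pk , ≤-refl , λ j Pj → ≮⇒≥ λ j<k → ∄l (j , j<k , Pj)

  -- The differences of elements of K are closed under subtraction, so their
  -- least positive member d divides all of them.
  gcd-is-difference : (K : Pred ℕ 0ℓ) → K 0 → (∀ {x y} → K x → K y → K (x + y)) →
    ∀ γ → (∀ d → (∀ {x} → K x → d ∣ x) → d ∣ γ) →
    ∃[ u ] ∃[ v ] K u × K v × u ≡ v + γ
  gcd-is-difference K K0 K+ γ greatest with em {∃[ x ] 0 < x × K x}
  -- Without positive members of `K`, 0 divides all of them, which forces `γ` to be 0.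
  ... | no ∄x = 0 , 0 , K0 , K0 , sym (0∣⇒≡0 (greatest 0 λ Kx → K-trivial Kx))
    where
    K-trivial : ∀ {x} → K x → 0 ∣ x
    K-trivial {zero}  _  = 0 ∣0
    K-trivial {suc x} Kx = contradiction (suc x , s≤s z≤n , Kx) ∄x
  ... | yes (x₀ , x₀>0 , Kx₀) = multiple (greatest d d∣K)
    where
    K* : ∀ q {x} → K x → K (q * x)
    K* zero    Kx = K0
    K* (suc q) Kx = K+ Kx (K* q Kx)

    D : Pred ℕ 0ℓ
    D d = ∃[ u ] ∃[ v ] K u × K v × u ≡ v + d

    -- (u - v) - (u′ - v′) = (u + v′) - (v + u′).
    D∸ : ∀ {x y r} → D x → D y → x ≡ y + r → D r
    D∸ {x} {y} {r} (u , v , Ku , Kv , refl) (u′ , v′ , Ku′ , Kv′ , refl) refl =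
      _ , _ , K+ Ku Kv′ , K+ Kv Ku′ , arithmetic v y r v′
      where
      arithmetic : ∀ v y r v′ → (v + (y + r)) + v′ ≡ (v + (v′ + y)) + r
      arithmetic = solve-∀

    D* : ∀ q {x} → D x → D (q * x)
    D* q {x} (u , v , Ku , Kv , refl) = _ , _ , K* q Ku , K* q Kv , *-distribˡ-+ q v x

    D>0-least = least (λ d → 0 < d × D d) x₀ (x₀>0 , x₀ , 0 , Kx₀ , K0 , refl)
    d         = proj₁ D>0-least
    d>0       = proj₁ (proj₁ (proj₂ D>0-least))
    Dd        = proj₂ (proj₁ (proj₂ D>0-least))
    d-least   = proj₂ (proj₂ (proj₂ D>0-least))

    instance
      d≢0 : NonZero d
      d≢0 = >-nonZero d>0

    d∣K : ∀ {x} → K x → d ∣ x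
    d∣K {x} Kx with x % d in eq
    ... | zero  = divides (x / d) (trans (m≡m%n+[m/n]*n x d) (cong (_+ x / d * d) eq))
    -- The remainder `x - (x / d) * d` would be a positive difference below `d`.
    ... | suc r = contradiction (m%n<n x d) (≤⇒≯ (d-least (x % d) (x%d>0 , Dr)))
      where
      x%d>0 : 0 < x % d
      x%d>0 = subst (0 <_) (sym eq) (s≤s z≤n)
      Dr : D (x % d)
      Dr = D∸ (x , 0 , Kx , K0 , refl) (D* (x / d) Dd)
             (trans (m≡m%n+[m/n]*n x d) (+-comm (x % d) _))

    multiple : d ∣ γ → D γ
    multiple (divides q refl) = D* q Dd

-- Walks of prescribed length

module _ {A : Set} where

  infixr 5 _∷ʷ_

  data Walk (E : Rel A 0ℓ) : ℕ → Rel A 0ℓ where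
    []ʷ  : ∀ {i} → Walk E 0 i i
    _∷ʷ_ : ∀ {k i j l} → E i j → Walk E k j l → Walk E (suc k) i l

  module _ {E : Rel A 0ℓ} where

    _++ʷ_ : ∀ {k l i j p} → Walk E k i j → Walk E l j p → Walk E (k + l) i p
    []ʷ      ++ʷ w′ = w′
    (e ∷ʷ w) ++ʷ w′ = e ∷ʷ (w ++ʷ w′)

    repeat : ∀ q {k i} → Walk E k i i → Walk E (q * k) i i
    repeat zero    w = []ʷ
    repeat (suc q) w = w ++ʷ repeat q w

    Walk⇒Star : ∀ {k} → Walk E k ⇒ Star E
    Walk⇒Star []ʷ      = []★
    Walk⇒Star (e ∷ʷ w) = e ◅ Walk⇒Star w

    Star⇒Walk : ∀ {i j} → Star E i j → ∃[ k ] Walk E k i j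
    Star⇒Walk []★     = 0 , []ʷ
    Star⇒Walk (e ◅ s) = _ , e ∷ʷ proj₂ (Star⇒Walk s)

    lastEdge : ∀ {k i j} → Walk E (suc k) i j → ∃[ p ] E p j
    lastEdge (e ∷ʷ []ʷ)        = _ , e
    lastEdge (_ ∷ʷ w@(_ ∷ʷ _)) = lastEdge w

  mapʷ : ∀ {E F : Rel A 0ℓ} → E ⇒ F → ∀ {k} → Walk E k ⇒ Walk F k
  mapʷ f []ʷ      = []ʷ
  mapʷ f (e ∷ʷ w) = f e ∷ʷ mapʷ f w

  mapStar : ∀ {E F : Rel A 0ℓ} → E ⇒ F → Star E ⇒ Star F
  mapStar f = Walk⇒Star ∘ mapʷ f ∘ proj₂ ∘ Star⇒Walk

module _ {n} {E : Rel (Fin n) 0ℓ} where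

  TransClosure⇒Walk : ∀ {i j} (w : TransClosure E i j) → Walk E (walkLength w) i j
  TransClosure⇒Walk [ e ]   = e ∷ʷ []ʷ
  TransClosure⇒Walk (e ∷ w) = e ∷ʷ TransClosure⇒Walk w

  Walk⇒TransClosure : ∀ {k i j} → Walk E (suc k) i j →
                      Σ (TransClosure E i j) λ w → walkLength w ≡ suc k
  Walk⇒TransClosure (e ∷ʷ []ʷ)        = [ e ] , refl
  Walk⇒TransClosure (e ∷ʷ w@(_ ∷ʷ _)) with Walk⇒TransClosure w
  ... | w′ , eq = e ∷ w′ , cong suc eq

  module _ {F : Rel (Fin n) 0ℓ} where

    -- Cutting a closed walk at one of its edges and rejoining the pieces at the base leads back
    -- along that edge, without leaving `F`.
    EdgeOnWalk⇒Star : ∀ {i j p q} (w : TransClosure E i j) →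
      (∀ {x y} → EdgeOnWalk x y w → F x y) →
      EdgeOnWalk p q w → Star F i p × Star F q j
    EdgeOnWalk⇒Star [ _ ]   ⊆F (refl , refl)        = []★ , []★
    EdgeOnWalk⇒Star (_ ∷ w) ⊆F (inj₁ (refl , refl)) = []★ , walk w (⊆F ∘ inj₂)
      where
      walk : ∀ {i j} (w : TransClosure E i j) →
             (∀ {x y} → EdgeOnWalk x y w → F x y) → Star F i j
      walk [ _ ]   ⊆F = ⊆F (refl , refl) ◅ []★
      walk (_ ∷ w) ⊆F = ⊆F (inj₁ (refl , refl)) ◅ walk w (⊆F ∘ inj₂)
    EdgeOnWalk⇒Star (_ ∷ w) ⊆F (inj₂ on) with EdgeOnWalk⇒Star w (⊆F ∘ inj₂) on
    ... | to , from = ⊆F (inj₁ (refl , refl)) ◅ to , from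

-- Roots and cyclic classes

-- `γ` is the period of `r`, the gcd of its closed walk lengths. Phrased for any `E`, so that it
-- applies both to the whole critical digraph and to a single component.
record IsRoot {A : Set} (E : Rel A 0ℓ) (γ : ℕ) (r : A) : Set where
  field
    positive : 0 < γ
    closed⇒∣ : ∀ {k} → Walk E k r r → γ ∣ k
    greatest : ∀ d → (∀ {k} → Walk E k r r → d ∣ k) → d ∣ γ
    returns  : ∀ {i} → Star E i r → Star E r i

module _ (em : ExcludedMiddle 0ℓ) {A : Set} {E : Rel A 0ℓ} where

  -- The detour uses lengths u = v + γ of closed walks at r: q copies of u and
  -- h q copies of v add γ q, and p copies of v with h p copies of u subtract
  -- γ p, both modulo suc h.
  walk-through-root : ∀ {γ r} → IsRoot E γ r → ∀ h {a x w b s} {i j} →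
    Walk E x i r → Walk E w r j → x + w ≡ a → γ ∣ a + s → γ ∣ b + s →
    ∃[ q ] Walk E (b + q * suc h) i j
  walk-through-root {γ} {r} root h {x = x} {w} {b} {s} {i} {j} wx ww refl (divides p eqₐ) (divides q eqb)
    with gcd-is-difference em (λ k → Walk E k r r) []ʷ _++ʷ_ γ (IsRoot.greatest root)
  ... | u , v , wu , wv , refl =
    -- Up to `q * γ` and `p * γ`, the `q` group has length `(q * v) * suc h` and the `p` group
    -- `(p * (v + γ)) * suc h`.
    q * v + p * (v + γ) , subst (λ k → Walk E k i j) length≡
          (wx ++ʷ (((repeat q wu ++ʷ repeat h (repeat q wv)) ++ʷ
                    (repeat p wv ++ʷ repeat h (repeat p wu))) ++ʷ ww))
    where
    -- Both sides equal `a + b + s`, where `a = x + w`.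
    shift : (x + w) + q * γ ≡ b + p * γ
    shift = trans (cong ((x + w) +_) (sym eqb))
              (trans (swap (x + w) b s) (cong (b +_) eqₐ))
      where
      swap : ∀ a b s → a + (b + s) ≡ b + (a + s)
      swap = solve-∀
    collectˡ : ∀ x w p q γ h v →
      x + (((q * (v + γ) + h * (q * v)) + (p * v + h * (p * (v + γ)))) + w)
      ≡ ((x + w) + q * γ) + (h * (q * v) + q * v + (p * v + h * (p * (v + γ))))
    collectˡ = solve-∀
    collectʳ : ∀ b p q γ h v →
      (b + p * γ) + (h * (q * v) + q * v + (p * v + h * (p * (v + γ))))
      ≡ b + (q * v + p * (v + γ)) * suc h
    collectʳ = solve-∀
    length≡ : x + (((q * (v + γ) + h * (q * v)) + (p * v + h * (p * (v + γ)))) + w)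
              ≡ b + (q * v + p * (v + γ)) * suc h
    length≡ = trans (collectˡ x w p q γ h v)
                (trans (cong (_+ (h * (q * v) + q * v + (p * v + h * (p * (v + γ))))) shift)
                  (collectʳ b p q γ h v))

  module _ {m} (γ : Vector ℕ m) (root : Fin m → A)
           (isRoot : ∀ ν → IsRoot E (γ ν) (root ν)) (M : ℕ) where

    -- The index (ν , c) stands for the cyclic class of the nodes from which
    -- root ν is reached in −c steps modulo γ ν.
    Leaves : A → Σ (Fin m) (Fin ∘ γ) → Set
    Leaves i (ν , c) = ∃[ x ] Walk E x i (root ν) × γ ν ∣ x + toℕ c

    -- A node that reaches `j` in `M` steps reaches the root in `M + z`, which is to be -c modulo
    -- `γ ν`.
    Enters : Σ (Fin m) (Fin ∘ γ) → A → Set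
    Enters (ν , c) j = ∃[ z ] Walk E z j (root ν) × γ ν ∣ toℕ c + (M + z)

    -- The endpoint reaches some root, which fixes `ν`; the length of the prolonged walk fixes `c`.
    -- Positivity of `M` supplies a last edge, hence an endpoint lying in a component.
    walk⇒class : 0 < M → (∀ {i j} → E i j → ∃[ ν ] Star E j (root ν)) →
      ∀ {i j} → Walk E M i j → ∃[ c ] Leaves i c × Enters c j
    walk⇒class (s≤s _) covers w with covers (proj₂ (lastEdge w))
    ... | ν , s with Star⇒Walk s
    ...   | z , wz with complement (γ ν) {{>-nonZero (IsRoot.positive (isRoot ν))}} (M + z)
    ...     | c , γ∣ = (ν , c) , (M + z , w ++ʷ wz , γ∣) ,
                       (z , wz , subst (γ ν ∣_) (+-comm (M + z) (toℕ c)) γ∣)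

    -- Closing up at the root gives `w ≡ -z`, so the walk through the root has length
    -- `x + w ≡ -(c + z) ≡ M` modulo `γ ν`. The detour makes it `M` plus whole periods, which
    -- `periodic` removes.
    class⇒walk : ∀ h → (∀ {i j} q → Walk E (M + q * suc h) i j → Walk E M i j) →
      ∀ {i j} c → Leaves i c → Enters c j → Walk E M i j
    class⇒walk h periodic (ν , c) (x , wx , γ∣x) (z , wz , γ∣z)
      with Star⇒Walk (IsRoot.returns (isRoot ν) (Walk⇒Star wz))
    ... | w , ww with walk-through-root (isRoot ν) h {b = M} {s = toℕ c + z} wx ww refl
                        (subst (γ ν ∣_) (arithmetic x w (toℕ c) z)
                           (∣m∣n⇒∣m+n γ∣x (IsRoot.closed⇒∣ (isRoot ν) (ww ++ʷ wz))))
                        (subst (γ ν ∣_) (arithmetic′ (toℕ c) M z) γ∣z)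
      where
      arithmetic : ∀ x w c z → x + c + (w + z) ≡ x + w + (c + z)
      arithmetic = solve-∀
      arithmetic′ : ∀ c M z → c + (M + z) ≡ M + (c + z)
      arithmetic′ = solve-∀
    ...   | q , w′ = periodic q w′

-- Components of the critical digraph

-- `reverse` puts every edge on a cycle, so no edge leads from one component to another.
module _ {n} (C : Digraph n) (reverse : ∀ {i j} → Edge C i j → Star (Edge C) j i) where

  reverse★ : ∀ {i j} → Star (Edge C) i j → Star (Edge C) j i
  reverse★ []★     = []★
  reverse★ (e ◅ s) = reverse★ s ◅◅ reverse e

  module Component (H : Digraph n) (r : Fin n) (H≃ : H ≃ component C r) where

    forget : Edge H ⇒ Edge C
    forget = proj₁ ∘ proj₁ (proj₂ H≃)

    -- Each inner node is reached from `r` through `p` and reaches `r` through `q`, so the walk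
    -- never leaves the component.
    restrict : ∀ {k p q} → Star (Edge C) r p → Star (Edge C) q r →
               Walk (Edge C) k p q → Walk (Edge H) k p q
    restrict r→p q→r []ʷ      = []ʷ
    restrict r→p q→r (e ∷ʷ w) =
      proj₂ (proj₂ H≃) (e , (proj₁ (endpoints C e) , r→p , e ◅ p′→r)
                          , (proj₂ (endpoints C e) , r→p′ , p′→r))
      ∷ʷ restrict r→p′ q→r w
      where
      p′→r = Walk⇒Star w ◅◅ q→r
      r→p′ = r→p ◅◅ (e ◅ []★)

    covers : ∀ {i j} → Edge H i j → Star (Edge H) j r
    covers e with proj₂ (proj₂ (proj₁ (proj₂ H≃) e))
    ... | _ , r→j , j→r =
      Walk⇒Star (restrict r→j []★ (proj₂ (Star⇒Walk j→r)))

    module _ (r-edge : ∃[ j ] Edge C r j) {γ} (isCyclicity : IsCyclicity H γ) where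

      closed⇒∣ : ∀ {k} → Walk (Edge C) k r r → γ ∣ k
      closed⇒∣ {zero}  w = γ ∣0
      closed⇒∣ {suc k} w with Walk⇒TransClosure (restrict []★ []★ w)
      ... | c , eq = subst (γ ∣_) eq (IsCyclicity.divides isCyclicity (r , c))

      isRoot : IsRoot (Edge C) γ r
      isRoot = record
        -- An edge at `r` and a way back form a closed walk of positive length, which 0 does not
        -- divide.
        { positive = n≢0⇒n>0 λ { refl → 0∤closed (closed⇒∣ closed) }
        ; closed⇒∣ = closed⇒∣
        ; greatest = λ d d∣ → IsCyclicity.greatest isCyclicity d (d∣cycle d d∣)
        ; returns  = reverse★
        }
        where
        closed : Walk (Edge C) (suc _) r r
        closed = proj₂ r-edge ∷ʷ proj₂ (Star⇒Walk (reverse (proj₂ r-edge)))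

        0∤closed : ∀ {k} → ¬ (0 ∣ suc k)
        0∤closed 0∣ with 0∣⇒≡0 0∣
        ... | ()

        -- A cycle based elsewhere is carried to `r` by walks of lengths `a` and `b`; `d` divides
        -- both `a + l + b` and `a + b`, hence `l`.
        d∣closed : ∀ d → (∀ {k} → Walk (Edge C) k r r → d ∣ k) →
                   ∀ {l p} → Walk (Edge H) l p p → d ∣ l
        d∣closed d d∣ {zero}  w = d ∣0
        d∣closed d d∣ {l@(suc _)} w@(e ∷ʷ _) with proj₁ (proj₂ (proj₁ (proj₂ H≃) e))
        ... | _ , r→p , p→r with Star⇒Walk r→p | Star⇒Walk p→r
        ...   | a , wa | b , wb =
          ∣m+n∣m⇒∣n (subst (d ∣_) (arithmetic a l b) (d∣ (wa ++ʷ (mapʷ forget w ++ʷ wb))))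
                    (d∣ (wa ++ʷ wb))
          where
          arithmetic : ∀ a l b → a + (l + b) ≡ (a + b) + l
          arithmetic = solve-∀

        d∣cycle : ∀ d → (∀ {k} → Walk (Edge C) k r r → d ∣ k) →
                  ∀ (c : Cycle H) → d ∣ cycleLength {G = H} c
        d∣cycle d d∣ (_ , w) = d∣closed d d∣ (TransClosure⇒Walk w)

      -- Closed walks at `r` are the same in `C` and in its component `H`.
      isRoot-component : IsRoot (Edge H) γ r
      isRoot-component = record
        { positive = IsRoot.positive isRoot
        ; closed⇒∣ = closed⇒∣ ∘ mapʷ forget
        ; greatest = λ d d∣ → IsRoot.greatest isRoot d (d∣ ∘ restrict []★ []★)
        ; returns  = λ s → let s′ = mapStar forget s in
            Walk⇒Star (restrict []★ s′ (proj₂ (Star⇒Walk (reverse★ s′))))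
        }

-- The tropical semiring and matrix factorisations

module _ (em : ExcludedMiddle 0ℓ) (ℝ : RealNumbers) where

  open Tropical em ℝ

  private
    module ℝ = RealNumbers ℝ

  open InfimumEquality ℝ._≈_ using (≈₋-isEquivalence; ⊥₋≈⊥₋; [_])
  open InfimumNonStrict ℝ._≤_ using (≤₋-minimum; ⊥₋≤_; [_])
  open NaturalMax ℝmax-totalOrder
    using (⊔-isSemigroup; ⊔-identityˡ; ⊔-comm; ⊔-idem; mono-≤-distrib-⊔)
  open Biased _≈₋_ using (isCommutativeMonoidˡ; isCommutativeSemiringˡ)

  ⊗-cong : Congruent₂ _≈₋_ _⊗_
  ⊗-cong [ p ]  [ q ]  = [ ℝ.+-cong p q ]
  ⊗-cong [ p ]  ⊥₋≈⊥₋ = ⊥₋≈⊥₋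
  ⊗-cong ⊥₋≈⊥₋ _      = ⊥₋≈⊥₋

  ⊗-assoc : Associative _≈₋_ _⊗_
  ⊗-assoc [ x ] [ y ] [ z ] = [ ℝ.+-assoc x y z ]
  ⊗-assoc [ x ] [ y ] ⊥₋    = ⊥₋≈⊥₋
  ⊗-assoc [ x ] ⊥₋    z     = ⊥₋≈⊥₋
  ⊗-assoc ⊥₋    y     z     = ⊥₋≈⊥₋

  ⊗-comm : Commutative _≈₋_ _⊗_
  ⊗-comm [ x ] [ y ] = [ ℝ.+-comm x y ]
  ⊗-comm [ x ] ⊥₋    = ⊥₋≈⊥₋
  ⊗-comm ⊥₋    [ y ] = ⊥₋≈⊥₋
  ⊗-comm ⊥₋    ⊥₋    = ⊥₋≈⊥₋

  ⊗-identityˡ : LeftIdentity _≈₋_ [ ℝ.0# ] _⊗_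
  ⊗-identityˡ [ x ] = [ ℝ.+-identityˡ x ]
  ⊗-identityˡ ⊥₋    = ⊥₋≈⊥₋

  ⊗-monoˡ-≤ : ∀ z {x y} → x ≤₋ y → (x ⊗ z) ≤₋ (y ⊗ z)
  ⊗-monoˡ-≤ z     (⊥₋≤ _) = ⊥₋≤ _
  ⊗-monoˡ-≤ [ z ] [ p ]    = [ ℝ.+-monoˡ-≤ _ _ z p ]
  ⊗-monoˡ-≤ ⊥₋    [ p ]    = ⊥₋≤ _

  ℝmax-commutativeSemiring : CommutativeSemiring 0ℓ 0ℓ
  ℝmax-commutativeSemiring = record
    { _+_ = _⊕_ ; _*_ = _⊗_ ; 0# = ε ; 1# = [ ℝ.0# ]
    ; isCommutativeSemiring = isCommutativeSemiringˡ record
      { +-isCommutativeMonoid = isCommutativeMonoidˡ record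
        { isSemigroup = ⊔-isSemigroup
        ; identityˡ   = ⊔-identityˡ ≤₋-minimum
        ; comm        = ⊔-comm
        }
      ; *-isCommutativeMonoid = isCommutativeMonoidˡ record
        { isSemigroup = record
          { isMagma = record
            { isEquivalence = ≈₋-isEquivalence ℝ.isEquivalence
            ; ∙-cong        = ⊗-cong
            }
          ; assoc = ⊗-assoc
          }
        ; identityˡ = ⊗-identityˡ
        ; comm      = ⊗-comm
        }
      -- Adding `z` is monotone, hence commutes with the maximum.
      ; distribʳ = λ z x y → mono-≤-distrib-⊔
          (λ x≈y → ⊗-cong x≈y (IsEquivalence.refl (≈₋-isEquivalence ℝ.isEquivalence)))
          (⊗-monoˡ-≤ z) x y
      ; zeroˡ = λ _ → ⊥₋≈⊥₋
      }
    }

  private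
    module ℝmax = CommutativeSemiring ℝmax-commutativeSemiring
  open SemiringSum ℝmax.semiring using (sum-cong-≋; ∑-comm; *-distribˡ-sum; *-distribʳ-sum)

  ⊗ᴹ-assoc : ∀ {n p q s} (A : Matrix n p) (B : Matrix p q) (D : Matrix q s) →
             (A ⊗ᴹ B) ⊗ᴹ D ≋ A ⊗ᴹ (B ⊗ᴹ D)
  ⊗ᴹ-assoc A B D i j = begin
    ⨁ (λ l → ⨁ (λ k → A i k ⊗ B k l) ⊗ D l j)
      ≈⟨ sum-cong-≋ (λ l → *-distribʳ-sum (D l j) (λ k → A i k ⊗ B k l)) ⟩
    ⨁ (λ l → ⨁ (λ k → (A i k ⊗ B k l) ⊗ D l j))
      ≈⟨ ∑-comm (λ l k → (A i k ⊗ B k l) ⊗ D l j) ⟩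
    ⨁ (λ k → ⨁ (λ l → (A i k ⊗ B k l) ⊗ D l j))
      ≈⟨ sum-cong-≋ (λ k → sum-cong-≋ (λ l → ⊗-assoc (A i k) (B k l) (D l j))) ⟩
    ⨁ (λ k → ⨁ (λ l → A i k ⊗ (B k l ⊗ D l j)))
      ≈⟨ sum-cong-≋ (λ k → *-distribˡ-sum (A i k) (λ l → B k l ⊗ D l j)) ⟨
    ⨁ (λ k → A i k ⊗ ⨁ (λ l → B k l ⊗ D l j)) ∎
    where open SetoidReasoning ℝmax.setoid

  factorises-⊗ˡ : ∀ {n p q r} (B : Matrix n p) {A : Matrix p q} →
                  Factorises A r → Factorises (B ⊗ᴹ A) r
  factorises-⊗ˡ B (U , L , A≋UL) = B ⊗ᴹ U , L , λ i j →
    ℝmax.trans (sum-cong-≋ λ l → ⊗-cong (ℝmax.refl {B i l}) (A≋UL l j))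
      (ℝmax.sym (⊗ᴹ-assoc B U L i j))

  factorises-⊗ʳ : ∀ {n p q r} (B : Matrix p q) {A : Matrix n p} →
                  Factorises A r → Factorises (A ⊗ᴹ B) r
  factorises-⊗ʳ B (U , L , A≋UL) = U , L ⊗ᴹ B , λ i j →
    ℝmax.trans (sum-cong-≋ λ l → ⊗-cong (A≋UL i l) (ℝmax.refl {B l j}))
      (⊗ᴹ-assoc U L B i j)

  -- One factorisation guarantees that a least inner dimension exists.
  factorises⇒rank≤ : ∀ {n p r} {A : Matrix n p} → Factorises A r → FactorRankAtMost A r
  factorises⇒rank≤ {A = A} f with least em (Factorises A) _ f
  ... | s , fₛ , s≤r , s-least = s , (fₛ , s-least) , s≤r

  -- Indicator matrices

  infix 4 _Indicates_

  _Indicates_ : ℝmax → Set → Set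
  x Indicates P = (P → x ≈₋ [ ℝ.0# ]) × (¬ P → x ≈₋ ε)

  indicator : Set → ℝmax
  indicator P = if does (em {P}) then [ ℝ.0# ] else ε

  indicator-indicates : ∀ P → indicator P Indicates P
  indicator-indicates P with em {P}
  ... | yes p = (λ _ → ℝmax.refl) , λ ¬p → contradiction p ¬p
  ... | no ¬p = (λ p → contradiction p ¬p) , λ _ → ℝmax.refl

  indicates-map : ∀ {x P Q} → (P → Q) → (Q → P) → x Indicates P → x Indicates Q
  indicates-map P⇒Q Q⇒P (pos , neg) = pos ∘ Q⇒P , λ ¬q → neg (¬q ∘ P⇒Q)

  indicates-≈ : ∀ {x y P} → x Indicates P → y Indicates P → x ≈₋ y
  indicates-≈ {P = P} (pos , neg) (pos′ , neg′) with em {P}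
  ... | yes p = ℝmax.trans (pos p) (ℝmax.sym (pos′ p))
  ... | no ¬p = ℝmax.trans (neg ¬p) (ℝmax.sym (neg′ ¬p))

  -- Since 0 and `ε` differ, an equality of entries transfers the existence of walks.
  indicates-reflects : ∀ {x y P Q} → x Indicates P → y Indicates Q → x ≈₋ y → P → Q
  indicates-reflects {Q = Q} (pos , _) (_ , neg) x≈y p with em {Q}
  ... | yes q = q
  ... | no ¬q with ℝmax.trans (ℝmax.sym (pos p)) (ℝmax.trans x≈y (neg ¬q))
  ...   | ()

  -- On the entries 0 and `ε` the tropical operations are Boolean: `⊗` acts as conjunction, `⊕` as
  -- disjunction and `⨁` as an existential.
  indicates-⊗ : ∀ {x y P Q} → x Indicates P → y Indicates Q → x ⊗ y Indicates (P × Q)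
  indicates-⊗ {x} {y} {P} (pos , neg) (pos′ , neg′) =
    (λ (p , q) → ℝmax.trans (⊗-cong (pos p) (pos′ q)) (⊗-identityˡ _)) , zero-⊗
    where
    zero-⊗ : ¬ (P × _) → x ⊗ y ≈₋ ε
    zero-⊗ ¬pq with em {P}
    ... | yes p = ℝmax.trans (⊗-cong (ℝmax.refl {x}) (neg′ λ q → ¬pq (p , q))) (ℝmax.zeroʳ x)
    ... | no ¬p = ⊗-cong (neg ¬p) (ℝmax.refl {y})

  indicates-⊕ : ∀ {x y P Q} → x Indicates P → y Indicates Q → x ⊕ y Indicates (P ⊎ Q)
  indicates-⊕ {x} {y} {P} {Q} (pos , neg) (pos′ , neg′) = unit , λ ¬pq →
    ℝmax.trans (ℝmax.+-cong (neg (¬pq ∘ inj₁)) (neg′ (¬pq ∘ inj₂))) (ℝmax.+-identityˡ ε)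
    where
    unit : P ⊎ Q → x ⊕ y ≈₋ [ ℝ.0# ]
    unit _ with em {P} | em {Q}
    unit _        | yes p | yes q = ℝmax.trans (ℝmax.+-cong (pos p) (pos′ q)) (⊔-idem _)
    unit _        | yes p | no ¬q = ℝmax.trans (ℝmax.+-cong (pos p) (neg′ ¬q)) (ℝmax.+-identityʳ _)
    unit _        | no ¬p | yes q = ℝmax.trans (ℝmax.+-cong (neg ¬p) (pos′ q)) (ℝmax.+-identityˡ _)
    unit (inj₁ p) | no ¬p | no _  = contradiction p ¬p
    unit (inj₂ q) | no _  | no ¬q = contradiction q ¬q

  indicates-⨁ : ∀ {r} {v : Vector ℝmax r} {P : Fin r → Set} →
                (∀ l → v l Indicates P l) → ⨁ v Indicates ∃ P
  indicates-⨁ {zero}  ind = (λ ()) , λ _ → ℝmax.refl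
  indicates-⨁ {suc r} ind = indicates-map
    (λ { (inj₁ p) → zero , p ; (inj₂ (l , p)) → suc l , p })
    (λ { (zero , p) → inj₁ p ; (suc l , p) → inj₂ (l , p) })
    (indicates-⊕ (ind zero) (indicates-⨁ (ind ∘ suc)))

  𝑆^-indicates : ∀ {n} (H : Digraph n) k i j →
                 (𝑆 H ^ᴹ k) i j Indicates Walk (Edge H) k i j
  𝑆^-indicates H zero i j with i ≟ j
  ... | yes refl = (λ _ → ℝmax.refl) , λ ¬w → contradiction []ʷ ¬w
  ... | no i≢j   = (λ { []ʷ → contradiction refl i≢j }) , λ _ → ℝmax.refl
  𝑆^-indicates H (suc k) i j = indicates-map
    (λ (_ , e , w) → e ∷ʷ w) (λ { (e ∷ʷ w) → _ , e , w })
    (indicates-⨁ λ l →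
      -- `𝑆 H i l` unfolds to `indicator (Edge H i l)`.
      indicates-⊗ (indicator-indicates (Edge H i l)) (𝑆^-indicates H k l j))

  -- Factorisation of high powers and of CSR terms

  module _ {n m} (H : Digraph n) (γ : Vector ℕ m) (root : Fin m → Fin n)
           (isRoot : ∀ ν → IsRoot (Edge H) (γ ν) (root ν))
           (covers : ∀ {i j} → Edge H i j → ∃[ ν ] Star (Edge H) j (root ν)) where

    power-factorises : ∀ {g T M} → IsPeriodicFrom (𝑆 H) (suc g) T → T ≤ M → 0 < M →
                       Factorises (𝑆 H ^ᴹ M) (sumAll γ)
    power-factorises {g} {T} {M} periodic T≤M M>0 =
      -- Column `s` of the left factor marks the nodes of class `s`; row `s` of the right factor
      -- marks the nodes `M` steps further on.
      (λ i s → indicator (Leaves′ i s)) , (λ s j → indicator (Enters′ s j)) , λ i j →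
      indicates-≈ (𝑆^-indicates H M i j) (indicates-map from to
        (indicates-⨁ λ s → indicates-⊗ (indicator-indicates (Leaves′ i s))
                                       (indicator-indicates (Enters′ s j))))
      where
      Leaves′ : Fin n → Fin (sumAll γ) → Set
      Leaves′ i s = Leaves em γ root isRoot M i (sumAll-index γ s)

      Enters′ : Fin (sumAll γ) → Fin n → Set
      Enters′ s j = Enters em γ root isRoot M (sumAll-index γ s) j

      -- Periodicity of the powers, read as a statement on walks, removes one period at a time;
      -- every length involved stays at least `M`, hence at least `T`.
      reduce : ∀ {i j} q → Walk (Edge H) (M + q * suc g) i j → Walk (Edge H) M i j
      reduce zero    w = subst (λ k → Walk (Edge H) k _ _) (+-identityʳ M) w
      reduce {i} {j} (suc q) w = reduce q
        (indicates-reflects (𝑆^-indicates H _ i j) (𝑆^-indicates H _ i j)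
          (periodic (M + q * suc g) (m≤n⇒m≤n+o _ T≤M) i j)
          (subst (λ k → Walk (Edge H) k i j) (rearrange M q g) w))
        where
        rearrange : ∀ M q g → M + suc q * suc g ≡ (M + q * suc g) + suc g
        rearrange = solve-∀

      from : ∀ {i j} → ∃[ s ] Leaves′ i s × Enters′ s j → Walk (Edge H) M i j
      from (s , leaves , enters) =
        class⇒walk em γ root isRoot M g reduce (sumAll-index γ s) leaves enters

      to : ∀ {i j} → Walk (Edge H) M i j → ∃[ s ] Leaves′ i s × Enters′ s j
      to w with walk⇒class em γ root isRoot M M>0 covers w
      ... | c , leaves , enters with sumAll-index-surjective γ c
      ...   | s , refl = s , leaves , enters

    -- Only the power inside the factor R is factorised; the matrices around it are absorbed into
    -- the outer factors.
    CSR-rank≤ : ∀ {g T} → 0 < g → IsPeriodicFrom (𝑆 H) g T → ∀ t → T ≤ t * g →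
                ∀ k Γ → FactorRankAtMost (CSR H g t k Γ) (sumAll γ)
    CSR-rank≤ {suc g} {T} _ periodic t T≤tg k Γ = factorises⇒rank≤
      (factorises-⊗ˡ _ (factorises-⊗ʳ Γ
        (power-factorises periodic (≤-trans T≤tg (<⇒≤ tg<M)) (≤-<-trans z≤n tg<M))))
      where
      -- As `k % suc g` is at most `g`, the exponent strictly exceeds `t * suc g`: it is past the
      -- transient and positive.
      tg<M : t * suc g < (t + 1) * suc g ∸ k % suc g
      tg<M = m+n≤o⇒m≤o∸n _ (begin
        suc (t * suc g) + k % suc g ≡⟨ +-suc (t * suc g) (k % suc g) ⟨
        t * suc g + suc (k % suc g) ≤⟨ +-monoʳ-≤ (t * suc g) (m%n<n k (suc g)) ⟩
        t * suc g + suc g           ≡⟨ rearrange t g ⟩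
        (t + 1) * suc g             ∎)
        where
        open ≤-Reasoning
        rearrange : ∀ t g → t * suc g + suc g ≡ (t + 1) * suc g
        rearrange = solve-∀

  -- All edges of a critical cycle are critical, so the rest of the cycle is a critical way back.
  critical-reverse : ∀ {n} (A : Matrix n n) {i j} →
    Edge (critical A) i j → Star (Edge (critical A)) j i
  critical-reverse A (c@(_ , w) , isCritical , on)
    with EdgeOnWalk⇒Star {F = Edge (critical A)} w (λ on′ → c , isCritical , on′) on
  ... | base→i , j→base = j→base ◅◅ base→i

-- Rank bounds under the standing assumptions

theorem3p10 : (em : ExcludedMiddle 0ℓ) (ℝ : RealNumbers) →
    let open Tropical em ℝ in
    (n : ℕ) (𝒳 : Pred (Matrix n n) 0ℓ)
    (Aˢᵘᵖ Aⁱⁿᶠ : Matrix n n) (G C : Digraph n) →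
    StandingAssumptions 𝒳 Aˢᵘᵖ Aⁱⁿᶠ G C →
    (m : ℕ) (𝐂 : Fin m → Digraph n) → AreComponents C 𝐂 →
    (γ : Fin m → ℕ) → (∀ ν → IsCyclicity (𝐂 ν) (γ ν)) →
    (k : ℕ) → 1 ≤ k →
    (A : Fin k → Matrix n n) → (∀ s → Normalised 𝒳 (A s)) →
    (∀ ν (T : ℕ) → IsTransient (𝑆 (𝐂 ν)) (γ ν) T →
    (t : ℕ) → T ≤ t * γ ν →
    FactorRankAtMost (CSR (𝐂 ν) (γ ν) t k (∏ A)) (γ ν))
    × (∀ (T : ℕ) → IsTransient (𝑆 C) (lcmAll γ) T →
    (t : ℕ) → T ≤ t * lcmAll γ →
    FactorRankAtMost (CSR C (lcmAll γ) t k (∏ A)) (sumAll γ))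
theorem3p10 em ℝ n 𝒳 Aˢᵘᵖ Aⁱⁿᶠ G C assumptions m 𝐂 areComponents γ isCyclicity k _ A _ =
    (λ ν T transient t T≤tγ →
      -- A single component is the case of one root, where the sum of cyclicities is `γ ν + 0`.
      subst (FactorRankAtMost (CSR (𝐂 ν) (γ ν) t k (∏ A))) (+-identityʳ (γ ν))
        (CSR-rank≤ em ℝ {m = 1} (𝐂 ν) (λ _ → γ ν) (λ _ → root ν)
          (λ _ → Comp.isRoot-component ν (root-edge ν) (isCyclicity ν)) (λ e → zero , Comp.covers ν e)
          (γ>0 ν) (proj₁ transient) t T≤tγ k (∏ A)))
  , (λ T transient t T≤tγ →
      CSR-rank≤ em ℝ C γ root isRoot covers
        (lcmAll>0 γ γ>0) (proj₁ transient) t T≤tγ k (∏ A))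
  where
  open Tropical em ℝ
  open StandingAssumptions assumptions using (nonempty; critical-𝒳)
  open AreComponents areComponents

  B  = proj₁ nonempty
  B≃ = critical-𝒳 B (proj₂ nonempty)

  reverse : ∀ {i j} → Edge C i j → Star (Edge C) j i
  reverse e = mapStar (proj₁ (proj₂ B≃)) (critical-reverse em ℝ B (proj₂ (proj₂ B≃) e))

  root : Fin m → Fin n
  root ν = proj₁ (isComponent ν)

  root∈C : ∀ ν → Node C (root ν)
  root∈C ν = proj₁ (proj₂ (isComponent ν))

  module Comp ν = Component C reverse (𝐂 ν) (root ν) (proj₂ (proj₂ (isComponent ν)))

  root-edge : ∀ ν → ∃[ j ] Edge C (root ν) j
  root-edge ν with proj₂ (proj₁ B≃) (root∈C ν)
  ... | inj₁ (j , e) = j , proj₁ (proj₂ B≃) e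
  -- The way back along an incoming edge starts with an outgoing one; if it is empty, the incoming
  -- edge is a loop.
  ... | inj₂ (j , e) with reverse (proj₁ (proj₂ B≃) e)
  ...   | []★    = j , proj₁ (proj₂ B≃) e
  ...   | e′ ◅ _ = _ , e′

  isRoot : ∀ ν → IsRoot (Edge C) (γ ν) (root ν)
  isRoot ν = Comp.isRoot ν (root-edge ν) (isCyclicity ν)

  γ>0 : ∀ ν → 0 < γ ν
  γ>0 ν = IsRoot.positive (isRoot ν)

  covers : ∀ {i j} → Edge C i j → ∃[ ν ] Star (Edge C) j (root ν)
  covers {j = j} e with exhaustive j (proj₂ (endpoints C e))
  -- `𝐂 ν` is here the component of `j`, and by `isComponent` also that of `root ν`, which `j`
  -- therefore reaches.
  ... | ν , 𝐂ν≃ = ν , proj₁ (proj₂ (proj₁ (proj₁ 𝐂ν≃) root∈𝐂ν))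
    where
    root∈𝐂ν : Node (𝐂 ν) (root ν)
    root∈𝐂ν = proj₂ (proj₁ (proj₂ (proj₂ (isComponent ν)))) (root∈C ν , []★ , []★)
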